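{- The class $\mathbf{Alg}\mathcal{LB}$ is the variety generated by $\mathcal{FOUR}$, i.e. the variety of distributive bilattices.
   Context: A bilattice is an algebra $\langle B,\land,\lor,\otimes,\oplus,\neg\rangle$ such that $\langle B,\land,\lor\rangle$ and $\langle B,\otimes,\oplus\rangle$ are lattices (not necessarily bounded) with associated orders $\leq_t$ and $\leq_k$, and $\neg$ is a unary operation such that for all $a,b$: $a\leq_t b$ implies $\neg b\leq_t\neg a$; $a\leq_k b$ implies $\neg a\leq_k\neg b$; $\neg\neg a=a$. It is distributive if $x\circ(y\bullet z)\approx(x\circ y)\bullet(x\circ z)$ holds for all distinct $\circ,\bullet\in\{\land,\lor,\otimes,\oplus\}$. $\mathcal{FOUR}$ is the bilattice with universe $\{\mathsf f,\bot,\top,\mathsf t\}$ with $\mathsf f <_t \bot,\top <_t \mathsf t$ ($\bot,\top$ $\leq_t$-incomparable), $\bot <_k \mathsf f,\mathsf t <_k \top$ ($\mathsf f,\mathsf t$ $\leq_k$-incomparable), and $\neg \mathsf f = \mathsf t$, $\neg\mathsf t=\mathsf f$, $\neg\bot=\bot$, $\neg\top=\top$. Let $\mathsf{Tr}=\{\top,\mathsf t\}$. $\mathbf{Fm}$ is the formula algebra over a countable set of variables in the language $\{\land,\lor,\otimes,\oplus,\neg\}$, and $\mathcal{LB}$ is the logic given by: $\Gamma\models_{\mathcal{LB}}\varphi$ iff for every homomorphism $h:\mathbf{Fm}\to\mathcal{FOUR}$, $h[\Gamma]\subseteq \mathsf{Tr}$ implies $h(\varphi)\in\mathsf{Tr}$.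 For an algebra $\mathbf A$ of this similarity type, a set $F\subseteq A$ is an $\mathcal{LB}$-filter if whenever $\Gamma\models_{\mathcal{LB}}\varphi$ and $h:\mathbf{Fm}\to\mathbf A$ is a homomorphism with $h[\Gamma]\subseteq F$, then $h(\varphi)\in F$. A g-matrix is a pair $\langle\mathbf A,\mathcal C\rangle$ with $\mathcal C$ a closure system on $A$; it is a g-model of $\mathcal{LB}$ if every member of $\mathcal C$ is an $\mathcal{LB}$-filter. Its Tarski congruence is the greatest congruence $\theta$ of $\mathbf A$ compatible with every $F\in\mathcal C$ (i.e. $a\in F$ and $\langle a,b\rangle\in\theta$ imply $b\in F$); the g-matrix is reduced if its Tarski congruence is the identity. $\mathbf{Alg}\mathcal{LB}$ is the class of all algebras $\mathbf A$ for which there is a reduced g-model $\langle\mathbf A,\mathcal C\rangle$ of $\mathcal{LB}$. -}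

module Defs where

open import Algebra.Core using (Op₁; Op₂)
open import Algebra.Definitions using (Congruent₁; Congruent₂; _DistributesOverˡ_)
open import Algebra.Lattice.Structures using (IsLattice)
open import Algebra.Morphism.Definitions using (Homomorphic₁; Homomorphic₂)
open import Data.Nat.Base using (ℕ)
open import Data.Product.Base using (Σ-syntax; _,_; proj₁)
open import Data.Sum.Base using (_⊎_)
open import Function.Definitions using (Congruent; Injective; Surjective)
open import Level using (Level; _⊔_; suc; 0ℓ)
open import Relation.Binary.Core using (Rel; _⇒_)
open import Relation.Binary.Definitions using (_Respects_)
open import Relation.Binary.PropositionalEquality using (_≡_; _≢_; cong; cong₂)
open import Relation.Binary.PropositionalEquality.Properties as ≡ using ()
open import Relation.Binary.Structures using (IsEquivalence)
open import Relation.Unary using (Pred; _∈_; _⊆_; _≐_; ⋂)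

-- The binary symbols ∧, ∨, ⊗, ⊕, in this order.

data Connective : Set where
  meetₜ joinₜ meetₖ joinₖ : Connective

-- As in the library's algebraic bundles, equality of elements is the
-- equivalence relation _≈_.  The carrier may be empty.

record Algebra (ℓ : Level) : Set (suc ℓ) where
  infix  4 _≈_ _≤ₜ_ _≤ₖ_
  infixr 6 _∧_ _∨_ _⊗_ _⊕_
  infix  8 ¬_
  field
    Carrier       : Set ℓ
    _≈_           : Rel Carrier ℓ
    isEquivalence : IsEquivalence _≈_
    ⟦_⟧           : Connective → Op₂ Carrier
    ¬_            : Op₁ Carrier
    ⟦⟧-cong       : ∀ c → Congruent₂ _≈_ ⟦ c ⟧
    ¬-cong        : Congruent₁ _≈_ ¬_

  _∧_ _∨_ _⊗_ _⊕_ : Op₂ Carrier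
  _∧_ = ⟦ meetₜ ⟧
  _∨_ = ⟦ joinₜ ⟧
  _⊗_ = ⟦ meetₖ ⟧
  _⊕_ = ⟦ joinₖ ⟧

  _≤ₜ_ _≤ₖ_ : Rel Carrier ℓ
  a ≤ₜ b = a ∧ b ≈ a
  a ≤ₖ b = a ⊗ b ≈ a

record Hom {a b : Level} (A : Algebra a) (B : Algebra b) : Set (a ⊔ b) where
  private
    module A = Algebra A
    module B = Algebra B
  field
    fun      : A.Carrier → B.Carrier
    fun-cong : Congruent A._≈_ B._≈_ fun
    ⟦⟧-homo  : ∀ c → Homomorphic₂ A.Carrier B.Carrier B._≈_ fun A.⟦ c ⟧ B.⟦ c ⟧
    ¬-homo   : Homomorphic₁ A.Carrier B.Carrier B._≈_ fun A.¬_ B.¬_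

module _ {ℓ : Level} (A : Algebra ℓ) where
  open Algebra A

  record IsBilattice : Set ℓ where
    field
      isLatticeₜ   : IsLattice _≈_ _∨_ _∧_
      isLatticeₖ   : IsLattice _≈_ _⊕_ _⊗_
      ¬-antitone   : ∀ {a b} → a ≤ₜ b → ¬ b ≤ₜ ¬ a
      ¬-monotone   : ∀ {a b} → a ≤ₖ b → ¬ a ≤ₖ ¬ b
      ¬-involutive : ∀ a → ¬ ¬ a ≈ a

  record IsDistributiveBilattice : Set ℓ where
    field
      isBilattice  : IsBilattice
      distributive : ∀ {c d} → c ≢ d → _DistributesOverˡ_ _≈_ ⟦ c ⟧ ⟦ d ⟧

-- Meets and joins for 𝐟 <ₜ ⊥ , ⊤ <ₜ 𝐭 and for ⊥ <ₖ 𝐟 , 𝐭 <ₖ ⊤.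

data Four (ℓ : Level) : Set ℓ where
  𝐟 ⊥ ⊤ 𝐭 : Four ℓ

module _ {ℓ : Level} where

  four : Connective → Op₂ (Four ℓ)
  four meetₜ 𝐭 y = y
  four meetₜ 𝐟 y = 𝐟
  four meetₜ ⊥ 𝐭 = ⊥
  four meetₜ ⊥ ⊥ = ⊥
  four meetₜ ⊥ ⊤ = 𝐟
  four meetₜ ⊥ 𝐟 = 𝐟
  four meetₜ ⊤ 𝐭 = ⊤
  four meetₜ ⊤ ⊤ = ⊤
  four meetₜ ⊤ ⊥ = 𝐟
  four meetₜ ⊤ 𝐟 = 𝐟
  four joinₜ 𝐟 y = y
  four joinₜ 𝐭 y = 𝐭
  four joinₜ ⊥ 𝐟 = ⊥
  four joinₜ ⊥ ⊥ = ⊥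
  four joinₜ ⊥ ⊤ = 𝐭
  four joinₜ ⊥ 𝐭 = 𝐭
  four joinₜ ⊤ 𝐟 = ⊤
  four joinₜ ⊤ ⊤ = ⊤
  four joinₜ ⊤ ⊥ = 𝐭
  four joinₜ ⊤ 𝐭 = 𝐭
  four meetₖ ⊤ y = y
  four meetₖ ⊥ y = ⊥
  four meetₖ 𝐟 ⊤ = 𝐟
  four meetₖ 𝐟 𝐟 = 𝐟
  four meetₖ 𝐟 𝐭 = ⊥
  four meetₖ 𝐟 ⊥ = ⊥
  four meetₖ 𝐭 ⊤ = 𝐭
  four meetₖ 𝐭 𝐭 = 𝐭
  four meetₖ 𝐭 𝐟 = ⊥
  four meetₖ 𝐭 ⊥ = ⊥
  four joinₖ ⊥ y = y
  four joinₖ ⊤ y = ⊤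
  four joinₖ 𝐟 ⊥ = 𝐟
  four joinₖ 𝐟 𝐟 = 𝐟
  four joinₖ 𝐟 𝐭 = ⊤
  four joinₖ 𝐟 ⊤ = ⊤
  four joinₖ 𝐭 ⊥ = 𝐭
  four joinₖ 𝐭 𝐭 = 𝐭
  four joinₖ 𝐭 𝐟 = ⊤
  four joinₖ 𝐭 ⊤ = ⊤

  fourNeg : Op₁ (Four ℓ)
  fourNeg 𝐟 = 𝐭
  fourNeg ⊥ = ⊥
  fourNeg ⊤ = ⊤
  fourNeg 𝐭 = 𝐟

  Tr : Pred (Four ℓ) ℓ
  Tr x = x ≡ ⊤ ⊎ x ≡ 𝐭

FOUR : (ℓ : Level) → Algebra ℓ
FOUR ℓ = record
  { Carrier       = Four ℓ
  ; _≈_           = _≡_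
  ; isEquivalence = ≡.isEquivalence
  ; ⟦_⟧           = four
  ; ¬_            = fourNeg
  ; ⟦⟧-cong       = λ c → cong₂ (four c)
  ; ¬-cong        = cong fourNeg
  }

data Formula : Set where
  var : ℕ → Formula
  app : Connective → Op₂ Formula
  neg : Op₁ Formula

Fm : Algebra 0ℓ
Fm = record
  { Carrier       = Formula
  ; _≈_           = _≡_
  ; isEquivalence = ≡.isEquivalence
  ; ⟦_⟧           = app
  ; ¬_            = neg
  ; ⟦⟧-cong       = λ c → cong₂ (app c)
  ; ¬-cong        = cong neg
  }

infix 4 _⊨_

_⊨_ : Pred Formula 0ℓ → Formula → Set
Γ ⊨ φ = (h : Hom Fm (FOUR 0ℓ)) → let open Hom h in
        (∀ {ψ} → ψ ∈ Γ → fun ψ ∈ Tr) → fun φ ∈ Tr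

module _ {ℓ : Level} (A : Algebra ℓ) where
  open Algebra A

  Subset : Set (suc ℓ)
  Subset = Σ[ F ∈ Pred Carrier ℓ ] F Respects _≈_

  IsLBFilter : Pred Subset (suc 0ℓ ⊔ ℓ)
  IsLBFilter (F , _) =
    ∀ Γ φ → Γ ⊨ φ → (h : Hom Fm A) → let open Hom h in
    (∀ {ψ} → ψ ∈ Γ → fun ψ ∈ F) → fun φ ∈ F

  -- Families are indexed by types in Set ℓ so that intersections stay at
  -- level ℓ.  Under excluded middle this covers every subcollection of 𝓒,
  -- since subsets of A then amount to maps Carrier → Bool.  Taking G to be
  -- any subset with the same elements as the intersection makes membership
  -- in 𝓒 extensional; the empty family puts the whole carrier into 𝓒.

  IsClosureSystem : Pred (Pred Subset (suc ℓ)) (suc ℓ)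
  IsClosureSystem 𝓒 =
    (I : Set ℓ) (F : I → Subset) → (∀ i → F i ∈ 𝓒) →
    (G : Subset) → proj₁ G ≐ ⋂ I (λ i → proj₁ (F i)) → G ∈ 𝓒

  -- Congruences contain _≈_, which is the identity of the algebra.

  record IsCongruence (θ : Rel Carrier ℓ) : Set ℓ where
    field
      isEquivalence : IsEquivalence θ
      reflexive     : _≈_ ⇒ θ
      ⟦⟧-compatible : ∀ c → Congruent₂ θ ⟦ c ⟧
      ¬-compatible  : Congruent₁ θ ¬_

  _CompatibleWith_ : Rel Carrier ℓ → Pred Subset (suc ℓ) → Set (suc ℓ)
  θ CompatibleWith 𝓒 = ∀ F → F ∈ 𝓒 → proj₁ F Respects θ

  record IsTarskiCongruence (𝓒 : Pred Subset (suc ℓ)) (θ : Rel Carrier ℓ) :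
                            Set (suc ℓ) where
    field
      isCongruence : IsCongruence θ
      compatible   : θ CompatibleWith 𝓒
      greatest     : ∀ η → IsCongruence η → η CompatibleWith 𝓒 → η ⇒ θ

  record ReducedGModel : Set (suc (suc ℓ)) where
    field
      𝓒               : Pred Subset (suc ℓ)
      isClosureSystem : IsClosureSystem 𝓒
      isGModel        : 𝓒 ⊆ IsLBFilter
      isReduced       : IsTarskiCongruence 𝓒 _≈_

AlgLB : {ℓ : Level} → Pred (Algebra ℓ) (suc (suc ℓ))
AlgLB A = ReducedGModel A

Π : {ℓ : Level} (I : Set ℓ) → (I → Algebra ℓ) → Algebra ℓ
Π I A = record
  { Carrier       = ∀ i → A.Carrier i
  ; _≈_           = λ x y → ∀ i → A._≈_ i (x i) (y i)
  ; isEquivalence = record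
    { refl  = λ i → IsEquivalence.refl (A.isEquivalence i)
    ; sym   = λ p i → IsEquivalence.sym (A.isEquivalence i) (p i)
    ; trans = λ p q i → IsEquivalence.trans (A.isEquivalence i) (p i) (q i)
    }
  ; ⟦_⟧           = λ c x y i → A.⟦_⟧ i c (x i) (y i)
  ; ¬_            = λ x i → A.¬_ i (x i)
  ; ⟦⟧-cong       = λ c p q i → A.⟦⟧-cong i c (p i) (q i)
  ; ¬-cong        = λ p i → A.¬-cong i (p i)
  }
  where module A i = Algebra (A i)

-- Subalgebras are taken up to isomorphism, as domains of embeddings.

data VarietyGeneratedBy {ℓ : Level} (K : Algebra ℓ) : Pred (Algebra ℓ) (suc ℓ) where
  generator   : K ∈ VarietyGeneratedBy K
  image       : ∀ {A B} (h : Hom B A) →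
                Surjective (Algebra._≈_ B) (Algebra._≈_ A) (Hom.fun h) →
                B ∈ VarietyGeneratedBy K → A ∈ VarietyGeneratedBy K
  subalgebra  : ∀ {A B} (h : Hom A B) →
                Injective (Algebra._≈_ A) (Algebra._≈_ B) (Hom.fun h) →
                B ∈ VarietyGeneratedBy K → A ∈ VarietyGeneratedBy K
  product     : (I : Set ℓ) (A : I → Algebra ℓ) →
                (∀ i → A i ∈ VarietyGeneratedBy K) → Π I A ∈ VarietyGeneratedBy K

{-# OPTIONS --safe #-}

module Submission where

-- Both AlgLB and the variety satisfy the equations of distributive bilattices:
-- equations pass to images, subalgebras and products, and in a reduced g-model
-- the congruence generated by their instances is compatible with every filter.
--
-- Conversely let A be a distributive bilattice, and put x ≤₁ y if x ≤ₜ m ≤ₖ y for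
-- some m.  Modulo ≤₁ the algebra A is a distributive lattice, ∧ and ⊗ both being
-- meets and ∨ and ⊕ joins, and x ≈ y as soon as x, y and ¬ x, ¬ y are
-- ≤₁-equivalent.  If x ≰₁ y, the pair (x , y) can be improved along any given
-- sequence z₀, z₁, … of elements to pairs (xₙ , yₙ) with xₙ decreasing, yₙ
-- increasing, xₙ ≰₁ yₙ, and xₙ₊₁ ≤₁ zₙ or zₙ ≤₁ yₙ₊₁.  This needs no choice
-- principle, and on the subalgebra generated by a sequence it yields a
-- homomorphism to FOUR designating x but not y.  Hence every equation valid in
-- FOUR holds in A, which is therefore an image of a subalgebra of a power of
-- FOUR; and every set { y : x ≤₁ y } is an LB-filter, so that the g-matrix of all
-- LB-filters is reduced.

open import Defs
open import Algebra.Bundles using (CommutativeSemigroup)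
import Algebra.Consequences.Setoid as Consequences
open import Algebra.Core using (Op₂)
open import Algebra.Definitions using (_DistributesOverˡ_; _DistributesOverʳ_)
open import Algebra.Lattice.Bundles using (Lattice)
import Algebra.Lattice.Properties.Lattice as LatticeProperties
open import Algebra.Lattice.Structures using (IsLattice; IsSemilattice)
import Algebra.Properties.CommutativeSemigroup as CommutativeSemigroupProperties
open import Axiom.ExcludedMiddle using (ExcludedMiddle)
open import Data.Bool.Base using (Bool; true; false) renaming (_∧_ to _&&_; _∨_ to _||_)
open import Data.Bool.Properties using () renaming (_≟_ to _≟ᵇ_)
open import Data.Nat.Base using (ℕ; zero; suc; _≤′_; ≤′-refl; ≤′-step; _⊔_)
open import Data.Nat.Properties using (≤⇒≤′; m≤m⊔n; m≤n⊔m)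
open import Data.Product.Base using (_×_; _,_; proj₁; proj₂; ∃)
open import Data.Sum.Base using (_⊎_; inj₁; inj₂)
open import Function.Base using (_∘_; id; const)
open import Level using (Level; 0ℓ; Lift; lift; lower) renaming (suc to lsuc)
open import Relation.Binary.Bundles using (Setoid)
open import Relation.Binary.Core using (Rel)
open import Relation.Binary.Definitions using (DecidableEquality; _Respects_)
import Relation.Binary.Lattice as Order
import Relation.Binary.Properties.Poset as PosetProperties
open import Relation.Binary.PropositionalEquality
  using (_≡_; refl; sym; trans; cong; cong₂; subst)
import Relation.Binary.Reasoning.Setoid as SetoidReasoning
open import Relation.Binary.Structures using (IsEquivalence; IsPartialOrder)
open import Relation.Nullary.Decidable using (Dec; yes; no; does; map′; from-yes; _×-dec_)
open import Relation.Nullary.Negation using (contradiction) renaming (¬_ to Not)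
open import Relation.Unary using (Pred; _∈_; _⊆_; _≐_; Decidable; ｛_｝)

private
  variable
    a b ℓ : Level

algebraSetoid : Algebra ℓ → Setoid ℓ ℓ
algebraSetoid A = record { isEquivalence = Algebra.isEquivalence A }

-- Evaluation of formulas

module _ (A : Algebra ℓ) where
  open Algebra A
  private module ≈ = IsEquivalence isEquivalence

  eval : (ℕ → Carrier) → Formula → Carrier
  eval e (var n)     = e n
  eval e (app c φ ψ) = ⟦ c ⟧ (eval e φ) (eval e ψ)
  eval e (neg φ)     = ¬ eval e φ

  evalHom : (ℕ → Carrier) → Hom Fm A
  evalHom e = record
    { fun      = eval e
    ; fun-cong = λ { refl → ≈.refl }
    ; ⟦⟧-homo  = λ _ _ _ → ≈.refl
    ; ¬-homo   = λ _ → ≈.refl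
    }

  eval-cong : ∀ {e e′} → (∀ n → e n ≈ e′ n) → ∀ φ → eval e φ ≈ eval e′ φ
  eval-cong e≈e′ (var n)     = e≈e′ n
  eval-cong e≈e′ (app c φ ψ) = ⟦⟧-cong c (eval-cong e≈e′ φ) (eval-cong e≈e′ ψ)
  eval-cong e≈e′ (neg φ)     = ¬-cong (eval-cong e≈e′ φ)

module _ {A : Algebra a} {B : Algebra b} (h : Hom A B) where
  open Hom h
  open Algebra B
  private module ≈ = IsEquivalence isEquivalence

  hom-eval : ∀ e φ → fun (eval A e φ) ≈ eval B (fun ∘ e) φ
  hom-eval e (var n)     = ≈.refl
  hom-eval e (app c φ ψ) =
    ≈.trans (⟦⟧-homo c _ _) (⟦⟧-cong c (hom-eval e φ) (hom-eval e ψ))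
  hom-eval e (neg φ)     = ≈.trans (¬-homo _) (¬-cong (hom-eval e φ))

-- Together with `hom-eval` this makes every homomorphism out of `Fm` the evaluation at its own
-- values on the variables.
eval-var : ∀ φ → eval Fm var φ ≡ φ
eval-var (var n)     = refl
eval-var (app c φ ψ) = cong₂ (app c) (eval-var φ) (eval-var ψ)
eval-var (neg φ)     = cong neg (eval-var φ)

rename : (ℕ → ℕ) → Formula → Formula
rename f = eval Fm (var ∘ f)

eval-rename : (A : Algebra ℓ) → let open Algebra A in
              ∀ e f φ → eval A e (rename f φ) ≈ eval A (e ∘ f) φ
eval-rename A e f = hom-eval (evalHom A e) (var ∘ f)

-- Prepending to sequences and interleaving them

infixr 5 _▷_
_▷_ : {X : Set a} → X → (ℕ → X) → ℕ → X
(x ▷ e) zero    = x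
(x ▷ e) (suc n) = e n

double : ℕ → ℕ
double zero    = zero
double (suc n) = suc (suc (double n))

-- Merges two assignments into one sequence, so that a single chain or a single term can serve both.
interleave : {X : Set a} → (ℕ → X) → (ℕ → X) → ℕ → X
interleave f g zero          = f zero
interleave f g (suc zero)    = g zero
interleave f g (suc (suc n)) = interleave (f ∘ suc) (g ∘ suc) n

interleave-even : {X : Set a} (f g : ℕ → X) → ∀ n → interleave f g (double n) ≡ f n
interleave-even f g zero    = refl
interleave-even f g (suc n) = interleave-even (f ∘ suc) (g ∘ suc) n

interleave-odd : {X : Set a} (f g : ℕ → X) → ∀ n → interleave f g (suc (double n)) ≡ g n
interleave-odd f g zero    = refl
interleave-odd f g (suc n) = interleave-odd (f ∘ suc) (g ∘ suc) n

-- Computations in FOUR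

-- Quantifiers over finite types are decidable, so the identities of FOUR below are checked by
-- evaluation through `from-yes`.
every : ∀ {P : Pred (Four a) b} → Decidable P → Dec (∀ x → P x)
every P? = map′ (λ (p , q , r , s) → λ { 𝐟 → p ; ⊥ → q ; ⊤ → r ; 𝐭 → s })
                (λ p → p 𝐟 , p ⊥ , p ⊤ , p 𝐭)
                (P? 𝐟 ×-dec P? ⊥ ×-dec P? ⊤ ×-dec P? 𝐭)

everyConnective : ∀ {P : Pred Connective b} → Decidable P → Dec (∀ c → P c)
everyConnective P? =
  map′ (λ (p , q , r , s) → λ { meetₜ → p ; joinₜ → q ; meetₖ → r ; joinₖ → s })
       (λ p → p meetₜ , p joinₜ , p meetₖ , p joinₖ)
       (P? meetₜ ×-dec P? joinₜ ×-dec P? meetₖ ×-dec P? joinₖ)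

_≟ᶜ_ : DecidableEquality Connective
meetₜ ≟ᶜ meetₜ = yes refl
meetₜ ≟ᶜ joinₜ = no λ ()
meetₜ ≟ᶜ meetₖ = no λ ()
meetₜ ≟ᶜ joinₖ = no λ ()
joinₜ ≟ᶜ meetₜ = no λ ()
joinₜ ≟ᶜ joinₜ = yes refl
joinₜ ≟ᶜ meetₖ = no λ ()
joinₜ ≟ᶜ joinₖ = no λ ()
meetₖ ≟ᶜ meetₜ = no λ ()
meetₖ ≟ᶜ joinₜ = no λ ()
meetₖ ≟ᶜ meetₖ = yes refl
meetₖ ≟ᶜ joinₖ = no λ ()
joinₖ ≟ᶜ meetₜ = no λ ()
joinₖ ≟ᶜ joinₜ = no λ ()
joinₖ ≟ᶜ meetₖ = no λ ()
joinₖ ≟ᶜ joinₖ = yes refl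

_≟⁴_ : DecidableEquality (Four a)
𝐟 ≟⁴ 𝐟 = yes refl
𝐟 ≟⁴ ⊥ = no λ ()
𝐟 ≟⁴ ⊤ = no λ ()
𝐟 ≟⁴ 𝐭 = no λ ()
⊥ ≟⁴ 𝐟 = no λ ()
⊥ ≟⁴ ⊥ = yes refl
⊥ ≟⁴ ⊤ = no λ ()
⊥ ≟⁴ 𝐭 = no λ ()
⊤ ≟⁴ 𝐟 = no λ ()
⊤ ≟⁴ ⊥ = no λ ()
⊤ ≟⁴ ⊤ = yes refl
⊤ ≟⁴ 𝐭 = no λ ()
𝐭 ≟⁴ 𝐟 = no λ ()
𝐭 ≟⁴ ⊥ = no λ ()
𝐭 ≟⁴ ⊤ = no λ ()
𝐭 ≟⁴ 𝐭 = yes refl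

opposite : Connective → Connective
opposite meetₜ = joinₜ
opposite joinₜ = meetₜ
opposite meetₖ = joinₖ
opposite joinₖ = meetₖ

-- Negation reverses the truth order only.

dual : Connective → Connective
dual meetₜ = joinₜ
dual joinₜ = meetₜ
dual meetₖ = meetₖ
dual joinₖ = joinₖ

module _ {a : Level} where

  four-comm : ∀ c (x y : Four a) → four c x y ≡ four c y x
  four-comm = from-yes (everyConnective λ c → every λ x → every λ y →
    four c x y ≟⁴ four c y x)

  four-assoc : ∀ c (x y z : Four a) → four c (four c x y) z ≡ four c x (four c y z)
  four-assoc = from-yes (everyConnective λ c → every λ x → every λ y → every λ z →
    four c (four c x y) z ≟⁴ four c x (four c y z))

  four-absorb : ∀ c (x y : Four a) → four c x (four (opposite c) x y) ≡ x
  four-absorb = from-yes (everyConnective λ c → every λ x → every λ y →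
    four c x (four (opposite c) x y) ≟⁴ x)

  four-distrib : ∀ c d (x y z : Four a) →
                 four c x (four d y z) ≡ four d (four c x y) (four c x z)
  four-distrib = from-yes (everyConnective λ c → everyConnective λ d →
    every λ x → every λ y → every λ z →
    four c x (four d y z) ≟⁴ four d (four c x y) (four c x z))

  four-deMorgan : ∀ c (x y : Four a) →
                  fourNeg (four c x y) ≡ four (dual c) (fourNeg x) (fourNeg y)
  four-deMorgan = from-yes (everyConnective λ c → every λ x → every λ y →
    fourNeg (four c x y) ≟⁴ four (dual c) (fourNeg x) (fourNeg y))

  fourNeg-involutive : ∀ (x : Four a) → fourNeg (fourNeg x) ≡ x
  fourNeg-involutive = from-yes (every λ x → fourNeg (fourNeg x) ≟⁴ x)

-- The equational theory of distributive bilattices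

private
  p q r : Formula
  p = var 0
  q = var 1
  r = var 2

-- The instances c = d of distributivity are redundant but spare a side condition.

data Axiom : Formula → Formula → Set where
  comm       : ∀ c → Axiom (app c p q) (app c q p)
  assoc      : ∀ c → Axiom (app c (app c p q) r) (app c p (app c q r))
  absorb     : ∀ c → Axiom (app c p (app (opposite c) p q)) p
  distrib    : ∀ c d → Axiom (app c p (app d q r)) (app d (app c p q) (app c p r))
  deMorgan   : ∀ c → Axiom (neg (app c p q)) (app (dual c) (neg p) (neg q))
  involutive : Axiom (neg (neg p)) p

Satisfies : Pred (Algebra ℓ) ℓ
Satisfies A = ∀ {φ ψ} → Axiom φ ψ → ∀ e → let open Algebra A in eval A e φ ≈ eval A e ψ

FOUR-satisfies : Satisfies (FOUR ℓ)
FOUR-satisfies (comm c)      e = four-comm c _ _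
FOUR-satisfies (assoc c)     e = four-assoc c (e 0) _ _
FOUR-satisfies (absorb c)    e = four-absorb c _ (e 1)
FOUR-satisfies (distrib c d) e = four-distrib c d (e 0) _ _
FOUR-satisfies (deMorgan c)  e = four-deMorgan c (e 0) _
FOUR-satisfies involutive    e = fourNeg-involutive _

-- Equations under images, subalgebras and products

variety⊆satisfies : {K : Algebra ℓ} → Satisfies K → VarietyGeneratedBy K ⊆ Satisfies
variety⊆satisfies K⊨ generator = K⊨
variety⊆satisfies K⊨ (image {A} {B} h surjective B∈V) {φ} {ψ} ax e = begin
  eval A e φ                  ≈⟨ eval-cong A f∘e′≈e φ ⟨
  eval A (fun ∘ e′) φ         ≈⟨ hom-eval h e′ φ ⟨
  fun (eval B e′ φ)           ≈⟨ fun-cong (variety⊆satisfies K⊨ B∈V ax e′) ⟩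
  fun (eval B e′ ψ)           ≈⟨ hom-eval h e′ ψ ⟩
  eval A (fun ∘ e′) ψ         ≈⟨ eval-cong A f∘e′≈e ψ ⟩
  eval A e ψ                  ∎
  where
  open Hom h
  open SetoidReasoning (algebraSetoid A)
  module B = IsEquivalence (Algebra.isEquivalence B)
  -- Surjectivity comes with explicit preimages, so the assignment lifts without choice.
  e′ : ℕ → Algebra.Carrier B
  e′ n = proj₁ (surjective (e n))
  f∘e′≈e : ∀ n → Algebra._≈_ A (fun (e′ n)) (e n)
  f∘e′≈e n = proj₂ (surjective (e n)) B.refl
variety⊆satisfies K⊨ (subalgebra {A} {B} h injective B∈V) {φ} {ψ} ax e = injective (begin
  fun (eval A e φ)    ≈⟨ hom-eval h e φ ⟩
  eval B (fun ∘ e) φ  ≈⟨ variety⊆satisfies K⊨ B∈V ax (fun ∘ e) ⟩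
  eval B (fun ∘ e) ψ  ≈⟨ hom-eval h e ψ ⟨
  fun (eval A e ψ)    ∎)
  where
  open Hom h
  open SetoidReasoning (algebraSetoid B)
variety⊆satisfies K⊨ (product I A A∈V) {φ} {ψ} ax e i = begin
  eval (Π I A) e φ i            ≈⟨ hom-eval π e φ ⟩
  eval (A i) (λ n → e n i) φ    ≈⟨ variety⊆satisfies K⊨ (A∈V i) ax (λ n → e n i) ⟩
  eval (A i) (λ n → e n i) ψ    ≈⟨ hom-eval π e ψ ⟨
  eval (Π I A) e ψ i            ∎
  where
  open SetoidReasoning (algebraSetoid (A i))
  module ≈ = IsEquivalence (Algebra.isEquivalence (A i))
  π : Hom (Π I A) (A i)
  π = record
    { fun      = λ x → x i
    ; fun-cong = λ x≈y → x≈y i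
    ; ⟦⟧-homo  = λ _ _ _ → ≈.refl
    ; ¬-homo   = λ _ → ≈.refl
    }

-- Distributive bilattices from the equations

module _ (A : Algebra ℓ) (A⊨ : Satisfies A) where
  open Algebra A
  private module ≈ = IsEquivalence isEquivalence
  open SetoidReasoning (algebraSetoid A)

  private
    assign : Carrier → Carrier → Carrier → ℕ → Carrier
    assign x y z = x ▷ y ▷ const z

    -- Absorption for `opposite c` mentions `opposite (opposite c)`, which does not reduce for a
    -- variable `c`; the equation is `refl` for each concrete connective.
    satisfies⇒isLattice : ∀ c → opposite (opposite c) ≡ c →
                          IsLattice _≈_ ⟦ opposite c ⟧ ⟦ c ⟧
    satisfies⇒isLattice c c°° = record
      { isEquivalence = isEquivalence
      ; ∨-comm        = λ x y → A⊨ (comm (opposite c)) (assign x y y)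
      ; ∨-assoc       = λ x y z → A⊨ (assoc (opposite c)) (assign x y z)
      ; ∨-cong        = ⟦⟧-cong (opposite c)
      ; ∧-comm        = λ x y → A⊨ (comm c) (assign x y y)
      ; ∧-assoc       = λ x y z → A⊨ (assoc c) (assign x y z)
      ; ∧-cong        = ⟦⟧-cong c
      ; absorptive    =
          (λ x y → subst (λ d → ⟦ opposite c ⟧ x (⟦ d ⟧ x y) ≈ x) c°°
                         (A⊨ (absorb (opposite c)) (assign x y y))) ,
          (λ x y → A⊨ (absorb c) (assign x y y))
      }

    satisfies⇒deMorgan : ∀ c x y → ¬ ⟦ c ⟧ x y ≈ ⟦ dual c ⟧ (¬ x) (¬ y)
    satisfies⇒deMorgan c x y = A⊨ (deMorgan c) (assign x y y)

  satisfies⇒isDistributiveBilattice : IsDistributiveBilattice A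
  satisfies⇒isDistributiveBilattice = record
    { isBilattice  = record
      { isLatticeₜ   = satisfies⇒isLattice meetₜ refl
      ; isLatticeₖ   = satisfies⇒isLattice meetₖ refl
      ; ¬-antitone   = λ {a} {b} a≤b → begin
          ¬ b ∧ ¬ a          ≈⟨ ⟦⟧-cong meetₜ ≈.refl (¬-cong a≤b) ⟨
          ¬ b ∧ ¬ (a ∧ b)    ≈⟨ ⟦⟧-cong meetₜ ≈.refl (satisfies⇒deMorgan meetₜ a b) ⟩
          ¬ b ∧ (¬ a ∨ ¬ b)  ≈⟨ ⟦⟧-cong meetₜ ≈.refl (A⊨ (comm joinₜ) (assign (¬ a) (¬ b) a)) ⟩
          ¬ b ∧ (¬ b ∨ ¬ a)  ≈⟨ A⊨ (absorb meetₜ) (assign (¬ b) (¬ a) a) ⟩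
          ¬ b                ∎
      ; ¬-monotone   = λ {a} {b} a≤b → begin
          ¬ a ⊗ ¬ b  ≈⟨ satisfies⇒deMorgan meetₖ a b ⟨
          ¬ (a ⊗ b)  ≈⟨ ¬-cong a≤b ⟩
          ¬ a        ∎
      ; ¬-involutive = λ x → A⊨ involutive (const x)
      }
    ; distributive = λ {c} {d} _ x y z → A⊨ (distrib c d) (assign x y z)
    }

-- Reduced g-models

-- The translations (unary polynomials with one hole) of Maltsev's description of generated
-- congruences; the parameters are elements of the algebra.
data Context {X : Set a} : Set a where
  hole       : Context
  left right : Connective → X → Context {X = X} → Context
  negated    : Context {X = X} → Context

module _ (A : Algebra ℓ) where
  open Algebra A
  private module ≈ = IsEquivalence isEquivalence

  -- Contexts are read from the inside out.

  plug : Context → Carrier → Carrier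
  plug hole          x = x
  plug (left  c a C) x = plug C (⟦ c ⟧ x a)
  plug (right c a C) x = plug C (⟦ c ⟧ a x)
  plug (negated C)   x = plug C (¬ x)

  FourEquivalent : Rel Formula 0ℓ
  FourEquivalent φ ψ = ∀ e → eval (FOUR 0ℓ) e φ ≡ eval (FOUR 0ℓ) e ψ

  module _ {F : Subset A} (isFilter : IsLBFilter A F) where

    private
      shift : Formula → Formula
      shift = rename suc

      ≈-shift : ∀ a e {x} φ → x ≈ eval A e φ → x ≈ eval A (a ▷ e) (shift φ)
      ≈-shift a e φ x≈φ = ≈.trans x≈φ (≈.sym (eval-rename A (a ▷ e) suc φ))

      shift-equivalent : ∀ {φ ψ} → FourEquivalent φ ψ → FourEquivalent (shift φ) (shift ψ)
      shift-equivalent {φ} {ψ} φ≡ψ e =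
        trans (eval-rename (FOUR 0ℓ) e suc φ)
              (trans (φ≡ψ (e ∘ suc)) (sym (eval-rename (FOUR 0ℓ) e suc ψ)))

    -- The parameters of the context become fresh variables of the two formulas.

    filter-replace : ∀ C {φ ψ} e {x y} → FourEquivalent φ ψ →
                     x ≈ eval A e φ → y ≈ eval A e ψ →
                     plug C x ∈ proj₁ F → plug C y ∈ proj₁ F
    filter-replace hole {φ} {ψ} e φ≡ψ x≈φ y≈ψ x∈F =
      proj₂ F (≈.sym y≈ψ)
        (isFilter ｛ φ ｝ ψ φ⊨ψ (evalHom A e) λ { refl → proj₂ F x≈φ x∈F })
      where
      φ⊨ψ : ｛ φ ｝ ⊨ ψ
      φ⊨ψ h designated = subst Tr h-φ≡h-ψ (designated refl)
        where
        open Hom h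
        h-eval : ∀ χ → fun χ ≡ eval (FOUR 0ℓ) (fun ∘ var) χ
        h-eval χ = trans (cong fun (sym (eval-var χ))) (hom-eval h var χ)
        h-φ≡h-ψ : fun φ ≡ fun ψ
        h-φ≡h-ψ = trans (h-eval φ) (trans (φ≡ψ (fun ∘ var)) (sym (h-eval ψ)))
    filter-replace (left c a C) {φ} {ψ} e φ≡ψ x≈φ y≈ψ =
      filter-replace C {app c (shift φ) (var 0)} {app c (shift ψ) (var 0)} (a ▷ e)
        (λ e′ → cong₂ (four c) (shift-equivalent {φ} {ψ} φ≡ψ e′) refl)
        (⟦⟧-cong c (≈-shift a e φ x≈φ) ≈.refl) (⟦⟧-cong c (≈-shift a e ψ y≈ψ) ≈.refl)
    filter-replace (right c a C) {φ} {ψ} e φ≡ψ x≈φ y≈ψ =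
      filter-replace C {app c (var 0) (shift φ)} {app c (var 0) (shift ψ)} (a ▷ e)
        (λ e′ → cong₂ (four c) refl (shift-equivalent {φ} {ψ} φ≡ψ e′))
        (⟦⟧-cong c ≈.refl (≈-shift a e φ x≈φ)) (⟦⟧-cong c ≈.refl (≈-shift a e ψ y≈ψ))
    filter-replace (negated C) {φ} {ψ} e φ≡ψ x≈φ y≈ψ =
      filter-replace C {neg φ} {neg ψ} e (cong fourNeg ∘ φ≡ψ) (¬-cong x≈φ) (¬-cong y≈ψ)

  -- The congruence generated by the axioms

  data AxiomCongruence : Rel Carrier ℓ where
    axiom      : ∀ {φ ψ} → Axiom φ ψ → ∀ e → AxiomCongruence (eval A e φ) (eval A e ψ)
    reflexive  : ∀ {x y} → x ≈ y → AxiomCongruence x y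
    symmetric  : ∀ {x y} → AxiomCongruence x y → AxiomCongruence y x
    transitive : ∀ {x y z} → AxiomCongruence x y → AxiomCongruence y z → AxiomCongruence x z
    compatible : ∀ c {x x′ y y′} → AxiomCongruence x x′ → AxiomCongruence y y′ →
                 AxiomCongruence (⟦ c ⟧ x y) (⟦ c ⟧ x′ y′)
    negation   : ∀ {x y} → AxiomCongruence x y → AxiomCongruence (¬ x) (¬ y)

  axiomCongruence-isCongruence : IsCongruence A AxiomCongruence
  axiomCongruence-isCongruence = record
    { isEquivalence = record
      { refl = reflexive ≈.refl ; sym = symmetric ; trans = transitive }
    ; reflexive     = reflexive
    ; ⟦⟧-compatible = compatible
    ; ¬-compatible  = negation
    }

  module _ {F : Subset A} (isFilter : IsLBFilter A F) where

    private
      replace : ∀ C {φ ψ} e {x y} → FourEquivalent φ ψ → x ≈ eval A e φ → y ≈ eval A e ψ →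
                plug C x ∈ proj₁ F → plug C y ∈ proj₁ F
      replace C {φ} {ψ} = filter-replace {F} isFilter C {φ} {ψ}

    -- Quantifying over all contexts lets compatibility with the operations be absorbed into a
    -- larger context; proving both directions at once handles symmetry.
    axiomCongruence-filter : ∀ {x y} → AxiomCongruence x y → ∀ C →
      (plug C x ∈ proj₁ F → plug C y ∈ proj₁ F) × (plug C y ∈ proj₁ F → plug C x ∈ proj₁ F)
    axiomCongruence-filter (axiom {φ} {ψ} ax e) C =
      replace C {φ} {ψ} e (FOUR-satisfies ax) ≈.refl ≈.refl ,
      replace C {ψ} {φ} e (sym ∘ FOUR-satisfies ax) ≈.refl ≈.refl
    axiomCongruence-filter (reflexive {x} x≈y) C =
      replace C {p} {p} (const x) (λ _ → refl) ≈.refl (≈.sym x≈y) ,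
      replace C {p} {p} (const x) (λ _ → refl) (≈.sym x≈y) ≈.refl
    axiomCongruence-filter (symmetric xθy) C =
      let x⇒y , y⇒x = axiomCongruence-filter xθy C in y⇒x , x⇒y
    axiomCongruence-filter (transitive xθy yθz) C =
      let x⇒y , y⇒x = axiomCongruence-filter xθy C
          y⇒z , z⇒y = axiomCongruence-filter yθz C
      in y⇒z ∘ x⇒y , y⇒x ∘ z⇒y
    axiomCongruence-filter (compatible c {x} {x′} {y} {y′} xθx′ yθy′) C =
      -- The arguments are replaced one at a time, passing through `⟦ c ⟧ x′ y`.
      let x⇒x′ , x′⇒x = axiomCongruence-filter xθx′ (left c y C)
          y⇒y′ , y′⇒y = axiomCongruence-filter yθy′ (right c x′ C)
      in y⇒y′ ∘ x⇒x′ , x′⇒x ∘ y′⇒y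
    axiomCongruence-filter (negation xθy) C = axiomCongruence-filter xθy (negated C)

-- In a reduced g-model `_≈_` is the greatest compatible congruence, so it contains
-- `AxiomCongruence`.
algLB⊆satisfies : AlgLB {ℓ} ⊆ Satisfies
algLB⊆satisfies {x = A} model ax e =
  greatest (AxiomCongruence A) (axiomCongruence-isCongruence A)
    (λ F F∈𝓒 xθy → proj₁ (axiomCongruence-filter A {F} (isGModel F∈𝓒) xθy hole))
    (axiom ax e)
  where
  open ReducedGModel model
  open IsTarskiCongruence isReduced

-- Distributive bilattices

module DistributiveBilattice {A : Algebra ℓ} (isDB : IsDistributiveBilattice A) where
  open Algebra A
  open IsDistributiveBilattice isDB
  open IsBilattice isBilattice
  private
    module ≈ = IsEquivalence isEquivalence
    Lₜ Lₖ : Lattice ℓ ℓ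
    Lₜ = record { isLattice = isLatticeₜ }
    Lₖ = record { isLattice = isLatticeₖ }
    module Lₜ = LatticeProperties Lₜ
    module Lₖ = LatticeProperties Lₖ
    module T = Order.Lattice Lₜ.∨-∧-orderTheoreticLattice
    module K = Order.Lattice Lₖ.∨-∧-orderTheoreticLattice
    open PosetProperties T.poset using () renaming (≥-isPartialOrder to ≥ₜ-isPartialOrder)
    open PosetProperties K.poset using () renaming (≥-isPartialOrder to ≥ₖ-isPartialOrder)

  isSemilattice : ∀ c → IsSemilattice _≈_ ⟦ c ⟧
  isSemilattice meetₜ = Lₜ.∧-isSemilattice
  isSemilattice joinₜ = Lₜ.∨-isSemilattice
  isSemilattice meetₖ = Lₖ.∧-isSemilattice
  isSemilattice joinₖ = Lₖ.∨-isSemilattice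

  private module S c = IsSemilattice _≈_ (isSemilattice c)

  distribˡ : ∀ c d → _DistributesOverˡ_ _≈_ ⟦ c ⟧ ⟦ d ⟧
  distribˡ c d with c ≟ᶜ d
  ... | no  c≢d  = distributive c≢d
  -- A semilattice operation distributes over itself: duplicate `x` and interchange.
  ... | yes refl = λ x y z → ≈.trans (⟦⟧-cong c (≈.sym (S.idem c x)) ≈.refl) (interchange x x y z)
    where
    commutativeSemigroup : CommutativeSemigroup ℓ ℓ
    commutativeSemigroup = record
      { isCommutativeSemigroup = record
        { isSemigroup = S.isSemigroup c ; comm = S.comm c } }
    open CommutativeSemigroupProperties commutativeSemigroup using (interchange)

  distribʳ : ∀ c d → _DistributesOverʳ_ _≈_ ⟦ c ⟧ ⟦ d ⟧
  distribʳ c d = Consequences.comm∧distrˡ⇒distrʳ (algebraSetoid A) (⟦⟧-cong d) (S.comm c)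
                                                 (distribˡ c d)

  -- The interlacing property: with d = ∧ or ⊗, every connective is monotone
  -- in both orders.

  interlacedʳ : ∀ c d {x y} z → x ≈ ⟦ d ⟧ x y → ⟦ c ⟧ x z ≈ ⟦ d ⟧ (⟦ c ⟧ x z) (⟦ c ⟧ y z)
  interlacedʳ c d {x} {y} z x≤y = ≈.trans (⟦⟧-cong c x≤y ≈.refl) (distribʳ c d z x y)

  interlacedˡ : ∀ c d {x y} z → x ≈ ⟦ d ⟧ x y → ⟦ c ⟧ z x ≈ ⟦ d ⟧ (⟦ c ⟧ z x) (⟦ c ⟧ z y)
  interlacedˡ c d {x} {y} z x≤y = ≈.trans (⟦⟧-cong c ≈.refl x≤y) (distribˡ c d z x y)

  -- Negation and the De Morgan laws

  ≤ₜ-¬ : ∀ {x y} → x T.≤ y → (¬ y) T.≤ (¬ x)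
  ≤ₜ-¬ x≤y = ≈.sym (¬-antitone (≈.sym x≤y))

  ≤ₖ-¬ : ∀ {x y} → x K.≤ y → (¬ x) K.≤ (¬ y)
  ≤ₖ-¬ x≤y = ≈.sym (¬-monotone (≈.sym x≤y))

  private
    -- An involution that is monotone both ways between two orders is an isomorphism and carries
    -- infima to infima. Reversed orders as instances give the laws for joins and the exchange of
    -- `∧` and `∨`.
    ¬-infimum : ∀ {_⊑_ _⊑′_ : Rel Carrier ℓ} {_∙_ _∙′_ : Op₂ Carrier} →
                IsPartialOrder _≈_ _⊑_ → IsPartialOrder _≈_ _⊑′_ →
                Order.Infimum _⊑_ _∙_ → Order.Infimum _⊑′_ _∙′_ →
                (∀ {x y} → x ⊑ y → (¬ x) ⊑′ (¬ y)) →
                (∀ {x y} → x ⊑′ y → (¬ x) ⊑ (¬ y)) →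
                ∀ x y → ¬ (x ∙ y) ≈ (¬ x) ∙′ (¬ y)
    ¬-infimum {_⊑_} {_⊑′_} {_∙_} {_∙′_} po po′ inf inf′ ¬⊑⊑′ ¬⊑′⊑ x y =
      P′.antisym
        (let _ , _ , greatest = inf′ (¬ x) (¬ y) ; l , r , _ = inf x y
         in greatest _ (¬⊑⊑′ l) (¬⊑⊑′ r))
        (let l , r , _ = inf′ (¬ x) (¬ y) ; _ , _ , greatest = inf x y
         in P′.trans (P′.reflexive (≈.sym (¬-involutive _)))
              (¬⊑⊑′ (greatest _ (P.trans (¬⊑′⊑ l) (P.reflexive (¬-involutive x)))
                                (P.trans (¬⊑′⊑ r) (P.reflexive (¬-involutive y))))))
      where
      module P  = IsPartialOrder po
      module P′ = IsPartialOrder po′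

  ¬-deMorgan : ∀ c x y → ¬ ⟦ c ⟧ x y ≈ ⟦ dual c ⟧ (¬ x) (¬ y)
  ¬-deMorgan meetₜ = ¬-infimum T.isPartialOrder ≥ₜ-isPartialOrder T.infimum T.supremum ≤ₜ-¬ ≤ₜ-¬
  ¬-deMorgan joinₜ = ¬-infimum ≥ₜ-isPartialOrder T.isPartialOrder T.supremum T.infimum ≤ₜ-¬ ≤ₜ-¬
  ¬-deMorgan meetₖ = ¬-infimum K.isPartialOrder K.isPartialOrder K.infimum K.infimum ≤ₖ-¬ ≤ₖ-¬
  ¬-deMorgan joinₖ = ¬-infimum ≥ₖ-isPartialOrder ≥ₖ-isPartialOrder K.supremum K.supremum ≤ₖ-¬ ≤ₖ-¬

  -- In FOUR this compares whether the values are designated, i.e. in Tr.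

  infix 4 _≤₁_
  record _≤₁_ (x y : Carrier) : Set ℓ where
    constructor via
    field
      {middle} : Carrier
      below    : x T.≤ middle
      above    : middle K.≤ y

  ≤ₜ⇒≤₁ : ∀ {x y} → x T.≤ y → x ≤₁ y
  ≤ₜ⇒≤₁ x≤y = via x≤y K.refl

  ≤ₖ⇒≤₁ : ∀ {x y} → x K.≤ y → x ≤₁ y
  ≤ₖ⇒≤₁ x≤y = via T.refl x≤y

  ≤₁-reflexive : ∀ {x y} → x ≈ y → x ≤₁ y
  ≤₁-reflexive x≈y = ≤ₜ⇒≤₁ (T.reflexive x≈y)

  ≤₁-refl : ∀ {x} → x ≤₁ x
  ≤₁-refl = ≤₁-reflexive ≈.refl

  -- If m ≤ₖ y ≤ₜ n then m ≤ₜ m ∨ n ≤ₖ y ∨ n ≈ n.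

  ≤₁-trans : ∀ {x y z} → x ≤₁ y → y ≤₁ z → x ≤₁ z
  ≤₁-trans (via {m} x≤m m≤y) (via {n} y≤n n≤z) =
    via (T.trans x≤m (T.x≤x∨y m n))
        (K.trans (K.trans (interlacedʳ joinₜ meetₖ n m≤y) (K.reflexive y∨n≈n)) n≤z)
    where
    y∨n≈n = T.antisym (T.∨-least y≤n T.refl) (T.y≤x∨y _ n)

  -- Interlacing makes `⟦ c ⟧ m y` a witness for the first argument and `⟦ c ⟧ x′ n` one for the
  -- second; transitivity joins the two.
  ≤₁-mono : ∀ c {x x′ y y′} → x ≤₁ x′ → y ≤₁ y′ → ⟦ c ⟧ x y ≤₁ ⟦ c ⟧ x′ y′
  ≤₁-mono c {x} {x′} {y} {y′} (via x≤m m≤x′) (via y≤n n≤y′) = ≤₁-trans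
    (via (interlacedʳ c meetₜ y x≤m) (interlacedʳ c meetₖ y m≤x′))
    (via (interlacedˡ c meetₜ x′ y≤n) (interlacedˡ c meetₖ x′ n≤y′))

  private
    -- A lower bound `z` equals `⟦ c ⟧ z z` by idempotence, and monotonicity puts this below
    -- `⟦ c ⟧ x y`.
    ≤₁-infimum : ∀ c → (∀ x y → ⟦ c ⟧ x y ≤₁ x) → (∀ x y → ⟦ c ⟧ x y ≤₁ y) →
                 Order.Infimum _≤₁_ ⟦ c ⟧
    ≤₁-infimum c ≤x ≤y x y = ≤x x y , ≤y x y , λ z z≤x z≤y →
      ≤₁-trans (≤₁-reflexive (≈.sym (S.idem c z))) (≤₁-mono c z≤x z≤y)

    ≤₁-supremum : ∀ c → (∀ x y → x ≤₁ ⟦ c ⟧ x y) → (∀ x y → y ≤₁ ⟦ c ⟧ x y) →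
                  Order.Supremum _≤₁_ ⟦ c ⟧
    ≤₁-supremum c x≤ y≤ x y = x≤ x y , y≤ x y , λ z x≤z y≤z →
      ≤₁-trans (≤₁-mono c x≤z y≤z) (≤₁-reflexive (S.idem c z))

  ∧-infimum₁ : Order.Infimum _≤₁_ _∧_
  ∧-infimum₁ = ≤₁-infimum meetₜ (λ x y → ≤ₜ⇒≤₁ (T.x∧y≤x x y)) (λ x y → ≤ₜ⇒≤₁ (T.x∧y≤y x y))

  ⊗-infimum₁ : Order.Infimum _≤₁_ _⊗_
  ⊗-infimum₁ = ≤₁-infimum meetₖ (λ x y → ≤ₖ⇒≤₁ (K.x∧y≤x x y)) (λ x y → ≤ₖ⇒≤₁ (K.x∧y≤y x y))

  ∨-supremum₁ : Order.Supremum _≤₁_ _∨_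
  ∨-supremum₁ = ≤₁-supremum joinₜ (λ x y → ≤ₜ⇒≤₁ (T.x≤x∨y x y)) (λ x y → ≤ₜ⇒≤₁ (T.y≤x∨y x y))

  ⊕-supremum₁ : Order.Supremum _≤₁_ _⊕_
  ⊕-supremum₁ = ≤₁-supremum joinₖ (λ x y → ≤ₖ⇒≤₁ (K.x≤x∨y x y)) (λ x y → ≤ₖ⇒≤₁ (K.y≤x∨y x y))

  -- The cut rule of distributive lattices: `x` lies below `x ∧ (y ∨ z) ≈ (x ∧ y) ∨ (x ∧ z)`, and
  -- both joinands lie below `y`.
  ≤₁-cut : ∀ {x y z} → x ∧ z ≤₁ y → x ≤₁ y ∨ z → x ≤₁ y
  ≤₁-cut {x} {y} {z} x∧z≤y x≤y∨z =
    let _ , _ , greatest = ∧-infimum₁ x (y ∨ z)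
        _ , x∧y≤y , _    = ∧-infimum₁ x y
        _ , _ , least    = ∨-supremum₁ (x ∧ y) (x ∧ z)
    in ≤₁-trans (greatest x ≤₁-refl x≤y∨z)
         (≤₁-trans (≤₁-reflexive (distribˡ meetₜ joinₜ x y z)) (least y x∧y≤y x∧z≤y))

  -- With `e = c ⊕ d`, interlacing squeezes `x ⊕ e` between `e` and `e` in the truth order, so `x`
  -- lies below `x ⊕ e ≈ e` in the knowledge order.
  between : ∀ {x c d} → d T.≤ x → x T.≤ c → x K.≤ c ⊕ d
  between {x} {c} {d} d≤x x≤c = K.trans (K.x≤x∨y x e) (K.reflexive (T.antisym x⊕e≤e e≤x⊕e))
    where
    e = c ⊕ d
    open SetoidReasoning (algebraSetoid A)
    x⊕d≤e : x ⊕ d T.≤ e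
    x⊕d≤e = interlacedʳ joinₖ meetₜ d x≤c
    e≤c⊕x : e T.≤ c ⊕ x
    e≤c⊕x = interlacedˡ joinₖ meetₜ c d≤x
    x⊕e≤e : x ⊕ e T.≤ e
    x⊕e≤e = T.trans (T.reflexive x⊕e≈c⊕[x⊕d]) (T.trans (interlacedˡ joinₖ meetₜ c x⊕d≤e)
                    (T.reflexive c⊕e≈e))
      where
      x⊕e≈c⊕[x⊕d] : x ⊕ e ≈ c ⊕ (x ⊕ d)
      x⊕e≈c⊕[x⊕d] = begin
        x ⊕ (c ⊕ d)  ≈⟨ S.assoc joinₖ x c d ⟨
        (x ⊕ c) ⊕ d  ≈⟨ ⟦⟧-cong joinₖ (S.comm joinₖ x c) ≈.refl ⟩
        (c ⊕ x) ⊕ d  ≈⟨ S.assoc joinₖ c x d ⟩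
        c ⊕ (x ⊕ d)  ∎
      c⊕e≈e : c ⊕ e ≈ e
      c⊕e≈e = ≈.trans (≈.sym (S.assoc joinₖ c c d)) (⟦⟧-cong joinₖ (S.idem joinₖ c) ≈.refl)
    e≤x⊕e : e T.≤ x ⊕ e
    e≤x⊕e = T.trans (T.reflexive e≈e⊕d) (T.trans (interlacedʳ joinₖ meetₜ d e≤c⊕x)
                    (T.reflexive [c⊕x]⊕d≈x⊕e))
      where
      e≈e⊕d : e ≈ e ⊕ d
      e≈e⊕d = ≈.trans (⟦⟧-cong joinₖ ≈.refl (≈.sym (S.idem joinₖ d)))
                      (≈.sym (S.assoc joinₖ c d d))
      [c⊕x]⊕d≈x⊕e : (c ⊕ x) ⊕ d ≈ x ⊕ e
      [c⊕x]⊕d≈x⊕e = ≈.trans (⟦⟧-cong joinₖ (S.comm joinₖ c x) ≈.refl) (S.assoc joinₖ x c d)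

  -- Negating the second witness gives `¬ d ≤ₜ x ≤ₜ c`, hence `x ≤ₖ c ⊕ ¬ d`, and both joinands are
  -- below `y` in the knowledge order.
  ≤₁×≤₁-¬⇒≤ₖ : ∀ {x y} → x ≤₁ y → ¬ x ≤₁ ¬ y → x K.≤ y
  ≤₁×≤₁-¬⇒≤ₖ {x} {y} (via {c} x≤c c≤y) (via {d} ¬x≤d d≤¬y) =
    K.trans (between ¬d≤x x≤c) (K.∨-least c≤y ¬d≤y)
    where
    ¬d≤x : ¬ d T.≤ x
    ¬d≤x = T.trans (≤ₜ-¬ ¬x≤d) (T.reflexive (¬-involutive x))
    ¬d≤y : ¬ d K.≤ y
    ¬d≤y = K.trans (≤ₖ-¬ d≤¬y) (K.reflexive (¬-involutive y))

  ≤₁-separates : ∀ {x y} → x ≤₁ y → y ≤₁ x → ¬ x ≤₁ ¬ y → ¬ y ≤₁ ¬ x → x ≈ y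
  ≤₁-separates x≤y y≤x ¬x≤¬y ¬y≤¬x =
    K.antisym (≤₁×≤₁-¬⇒≤ₖ x≤y ¬x≤¬y) (≤₁×≤₁-¬⇒≤ₖ y≤x ¬y≤¬x)

-- FOUR as the square of the two-element lattice

designated : Four a → Bool
designated 𝐟 = false
designated ⊥ = false
designated ⊤ = true
designated 𝐭 = true

fromBits : Bool → Bool → Four a
fromBits false false = ⊥
fromBits false true  = 𝐟
fromBits true  false = 𝐭
fromBits true  true  = ⊤

designated-fromBits : ∀ s t → designated (fromBits {a} s t) ≡ s
designated-fromBits false false = refl
designated-fromBits false true  = refl
designated-fromBits true  false = refl
designated-fromBits true  true  = refl

designated-¬-fromBits : ∀ s t → designated (fourNeg (fromBits {a} s t)) ≡ t
designated-¬-fromBits false false = refl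
designated-¬-fromBits false true  = refl
designated-¬-fromBits true  false = refl
designated-¬-fromBits true  true  = refl

designated⇒Tr : ∀ {w : Four a} → designated w ≡ true → w ∈ Tr
designated⇒Tr {w = ⊤} _ = inj₁ refl
designated⇒Tr {w = 𝐭} _ = inj₂ refl

Tr⇒designated : ∀ {w : Four a} → w ∈ Tr → designated w ≡ true
Tr⇒designated (inj₁ refl) = refl
Tr⇒designated (inj₂ refl) = refl

boolOp : Connective → Op₂ Bool
boolOp meetₜ = _&&_
boolOp joinₜ = _||_
boolOp meetₖ = _&&_
boolOp joinₖ = _||_

designated-homo : ∀ c (v w : Four a) →
                  designated (four c v w) ≡ boolOp c (designated v) (designated w)
designated-homo = from-yes (everyConnective λ c → every λ v → every λ w →
  designated (four c v w) ≟ᵇ boolOp c (designated v) (designated w))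

-- Separation of elements by valuations in FOUR

module Separation {A : Algebra ℓ} (isDB : IsDistributiveBilattice A)
                  (em : ExcludedMiddle ℓ) where
  open Algebra A
  open IsDistributiveBilattice isDB
  open IsBilattice isBilattice
  open DistributiveBilattice isDB
  private module ≈ = IsEquivalence isEquivalence

  record Gap : Set ℓ where
    constructor gap
    field
      floor ceiling : Carrier
      separated     : Not (floor ≤₁ ceiling)
  open Gap

  -- By the cut rule, lowering the floor to `x ∧ z` and raising the ceiling to `y ∨ z` cannot both
  -- close the gap.
  refine : Carrier → Gap → Gap
  refine z (gap x y x≰y) with em {x ∧ z ≤₁ y}
  ... | no  x∧z≰y = gap (x ∧ z) y x∧z≰y
  ... | yes x∧z≤y = gap x (y ∨ z) (x≰y ∘ ≤₁-cut x∧z≤y)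

  floor-refine : ∀ z g → floor (refine z g) ≤₁ floor g
  floor-refine z (gap x y _) with em {x ∧ z ≤₁ y}
  ... | no  _ = proj₁ (∧-infimum₁ x z)
  ... | yes _ = ≤₁-refl

  ceiling-refine : ∀ z g → ceiling g ≤₁ ceiling (refine z g)
  ceiling-refine z (gap x y _) with em {x ∧ z ≤₁ y}
  ... | no  _ = ≤₁-refl
  ... | yes _ = proj₁ (∨-supremum₁ y z)

  refine-decides : ∀ z g → floor (refine z g) ≤₁ z ⊎ z ≤₁ ceiling (refine z g)
  refine-decides z (gap x y _) with em {x ∧ z ≤₁ y}
  ... | no  _ = inj₁ (proj₁ (proj₂ (∧-infimum₁ x z)))
  ... | yes _ = inj₂ (proj₁ (proj₂ (∨-supremum₁ y z)))

  module _ {x y : Carrier} (x≰y : Not (x ≤₁ y)) (e : ℕ → Carrier) where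

    private
      -- Negations are included because the second bit of a value in FOUR is read off from the side
      -- of the negated element.
      e± : ℕ → Carrier
      e± = interleave e (¬_ ∘ e)

    chain : ℕ → Gap
    chain zero    = gap x y x≰y
    chain (suc n) = refine (e± n) (chain n)

    floor-antitone : ∀ {m n} → m ≤′ n → floor (chain n) ≤₁ floor (chain m)
    floor-antitone ≤′-refl       = ≤₁-refl
    floor-antitone (≤′-step {n} m≤n) = ≤₁-trans (floor-refine (e± n) (chain n)) (floor-antitone m≤n)

    ceiling-monotone : ∀ {m n} → m ≤′ n → ceiling (chain m) ≤₁ ceiling (chain n)
    ceiling-monotone ≤′-refl       = ≤₁-refl
    ceiling-monotone (≤′-step {n} m≤n) =
      ≤₁-trans (ceiling-monotone m≤n) (ceiling-refine (e± n) (chain n))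

    -- The filter generated by the floors and the ideal generated by the ceilings.

    Side : Bool → Pred Carrier ℓ
    Side true  z = ∃ λ n → floor (chain n) ≤₁ z
    Side false z = ∃ λ n → z ≤₁ ceiling (chain n)

    private
      ≤⊔ˡ : ∀ m n → m ≤′ m ⊔ n
      ≤⊔ˡ m n = ≤⇒≤′ (m≤m⊔n m n)

      ≤⊔ʳ : ∀ m n → n ≤′ m ⊔ n
      ≤⊔ʳ m n = ≤⇒≤′ (m≤n⊔m m n)

    -- At the common stage `m ⊔ n` the floor would lie below the ceiling.
    Side-disjoint : ∀ {z} → z ∈ Side true → Not (z ∈ Side false)
    Side-disjoint (m , floor≤z) (n , z≤ceiling) = separated (chain (m ⊔ n))
      (≤₁-trans (floor-antitone (≤⊔ˡ m n))
        (≤₁-trans floor≤z (≤₁-trans z≤ceiling (ceiling-monotone (≤⊔ʳ m n)))))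

    Side-unique : ∀ s t {z} → z ∈ Side s → z ∈ Side t → s ≡ t
    Side-unique true  true  _ _ = refl
    Side-unique true  false p q = contradiction q (Side-disjoint p)
    Side-unique false true  p q = contradiction p (Side-disjoint q)
    Side-unique false false _ _ = refl

    Side-upward : ∀ {z z′} → z ≤₁ z′ → z ∈ Side true → z′ ∈ Side true
    Side-upward z≤z′ (n , floor≤z) = n , ≤₁-trans floor≤z z≤z′

    Side-downward : ∀ {z z′} → z ≤₁ z′ → z′ ∈ Side false → z ∈ Side false
    Side-downward z≤z′ (n , z′≤ceiling) = n , ≤₁-trans z≤z′ z′≤ceiling

    Side-resp : ∀ s → Side s Respects _≈_
    Side-resp true  z≈z′ = Side-upward (≤₁-reflexive z≈z′)
    Side-resp false z≈z′ = Side-downward (≤₁-reflexive (≈.sym z≈z′))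

    private
      Side-infimum : ∀ {_∙_ : Op₂ Carrier} → Order.Infimum _≤₁_ _∙_ →
                     ∀ s t {z w} → z ∈ Side s → w ∈ Side t → z ∙ w ∈ Side (s && t)
      Side-infimum inf true true {z} {w} (m , p) (n , q) =
        let _ , _ , greatest = inf z w
        in m ⊔ n , greatest _ (≤₁-trans (floor-antitone (≤⊔ˡ m n)) p)
                              (≤₁-trans (floor-antitone (≤⊔ʳ m n)) q)
      Side-infimum inf true  false {z} {w} _ q = Side-downward (proj₁ (proj₂ (inf z w))) q
      Side-infimum inf false _     {z} {w} p _ = Side-downward (proj₁ (inf z w)) p

      Side-supremum : ∀ {_∙_ : Op₂ Carrier} → Order.Supremum _≤₁_ _∙_ →
                      ∀ s t {z w} → z ∈ Side s → w ∈ Side t → z ∙ w ∈ Side (s || t)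
      Side-supremum sup false false {z} {w} (m , p) (n , q) =
        let _ , _ , least = sup z w
        in m ⊔ n , least _ (≤₁-trans p (ceiling-monotone (≤⊔ˡ m n)))
                           (≤₁-trans q (ceiling-monotone (≤⊔ʳ m n)))
      Side-supremum sup false true {z} {w} _ q = Side-upward (proj₁ (proj₂ (sup z w))) q
      Side-supremum sup true  _    {z} {w} p _ = Side-upward (proj₁ (sup z w)) p

    Side-op : ∀ c s t {z w} → z ∈ Side s → w ∈ Side t → ⟦ c ⟧ z w ∈ Side (boolOp c s t)
    Side-op meetₜ = Side-infimum ∧-infimum₁
    Side-op joinₜ = Side-supremum ∨-supremum₁
    Side-op meetₖ = Side-infimum ⊗-infimum₁
    Side-op joinₖ = Side-supremum ⊕-supremum₁

    infix 4 _∼_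
    -- The graph of a partial homomorphism to FOUR. A relation is used because elements outside the
    -- subalgebra generated by the sequence may lie on neither side.
    _∼_ : Carrier → Four b → Set ℓ
    z ∼ w = z ∈ Side (designated w) × ¬ z ∈ Side (designated (fourNeg w))

    ∼-resp : ∀ {w : Four b} → (_∼ w) Respects _≈_
    ∼-resp z≈z′ (p , q) = Side-resp _ z≈z′ p , Side-resp _ (¬-cong z≈z′) q

    ∼-op : ∀ c {z z′} {w w′ : Four b} → z ∼ w → z′ ∼ w′ → ⟦ c ⟧ z z′ ∼ four c w w′
    ∼-op c {z} {z′} {w} {w′} (p , q) (p′ , q′) =
      subst (λ s → ⟦ c ⟧ z z′ ∈ Side s) (sym (designated-homo c w w′)) (Side-op c _ _ p p′) ,
      Side-resp _ (≈.sym (¬-deMorgan c z z′))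
        (subst (λ s → ⟦ dual c ⟧ (¬ z) (¬ z′) ∈ Side s)
          (sym (trans (cong designated (four-deMorgan c w w′))
                      (designated-homo (dual c) (fourNeg w) (fourNeg w′))))
          (Side-op (dual c) _ _ q q′))

    ∼-neg : ∀ {z} {w : Four b} → z ∼ w → ¬ z ∼ fourNeg w
    ∼-neg {w = w} (p , q) = q ,
      Side-resp _ (≈.sym (¬-involutive _))
        (subst (λ v → _ ∈ Side (designated v)) (sym (fourNeg-involutive w)) p)

    ∼-eval : ∀ {e′ : ℕ → Carrier} {v : ℕ → Four b} → (∀ n → e′ n ∼ v n) →
             ∀ φ → eval A e′ φ ∼ eval (FOUR b) v φ
    ∼-eval e′∼v (var n)     = e′∼v n
    ∼-eval e′∼v (app c φ ψ) = ∼-op c (∼-eval e′∼v φ) (∼-eval e′∼v ψ)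
    ∼-eval e′∼v (neg φ)     = ∼-neg (∼-eval e′∼v φ)

    -- An element on neither side gets the default `false`; `side-correct` concerns decided elements
    -- only.
    side : Carrier → Bool
    side z = does (em {z ∈ Side true})

    valuation : Carrier → Four b
    valuation z = fromBits (side z) (side (¬ z))

    private
      decided : ∀ n → e± n ∈ Side true ⊎ e± n ∈ Side false
      decided n with refine-decides (e± n) (chain n)
      -- The element at position `n` is decided at stage `suc n`, where the chain has been refined
      -- by it.
      ... | inj₁ p = inj₁ (suc n , p)
      ... | inj₂ p = inj₂ (suc n , p)

      side-correct : ∀ {z} → z ∈ Side true ⊎ z ∈ Side false → z ∈ Side (side z)
      side-correct {z} d with em {z ∈ Side true} | d
      ... | yes p | _      = p
      ... | no ¬p | inj₁ p = contradiction p ¬p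
      ... | no ¬p | inj₂ p = p

    valuation-∼ : ∀ n → e n ∼ valuation {b} (e n)
    valuation-∼ n =
      subst (λ s → e n ∈ Side s) (sym (designated-fromBits _ _))
        (side-correct (subst (λ z → z ∈ Side true ⊎ z ∈ Side false)
          (interleave-even e (¬_ ∘ e) n) (decided (double n)))) ,
      subst (λ s → ¬ e n ∈ Side s) (sym (designated-¬-fromBits _ _))
        (side-correct (subst (λ z → z ∈ Side true ⊎ z ∈ Side false)
          (interleave-odd e (¬_ ∘ e) n) (decided (suc (double n)))))

  -- A FOUR-valid equation cannot fail in A in the order ≤₁: a failure would be
  -- separated, along the values of all variables involved, by a valuation.

  valid⇒≤₁ : ∀ φ ψ (e e′ : ℕ → Carrier) →
    (∀ v → eval (FOUR b) (v ∘ e) φ ≡ eval (FOUR b) (v ∘ e′) ψ) →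
    eval A e φ ≤₁ eval A e′ ψ
  valid⇒≤₁ {b} φ ψ e e′ valid with em {eval A e φ ≤₁ eval A e′ ψ}
  ... | yes φ≤ψ = φ≤ψ
  ... | no  φ≰ψ = contradiction ψ∈false (Side-disjoint φ≰ψ ē ψ∈true)
    where
    -- One chain must decide the values of both assignments.
    ē : ℕ → Carrier
    ē = interleave e e′
    infix 4 _≃_
    _≃_ : Carrier → Four b → Set ℓ
    _≃_ = _∼_ φ≰ψ ē
    v : Carrier → Four b
    v = valuation φ≰ψ ē
    e∼v : ∀ n → e n ≃ v (e n)
    e∼v n = subst (λ z → z ≃ v z) (interleave-even e e′ n) (valuation-∼ φ≰ψ ē (double n))
    e′∼v : ∀ n → e′ n ≃ v (e′ n)
    e′∼v n = subst (λ z → z ≃ v z) (interleave-odd e e′ n) (valuation-∼ φ≰ψ ē (suc (double n)))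
    φ-true : true ≡ designated (eval (FOUR b) (v ∘ e) φ)
    -- At stage 0 the floor is the value of `φ` and the ceiling that of `ψ`.
    φ-true = Side-unique φ≰ψ ē _ _ (0 , ≤₁-refl) (proj₁ (∼-eval φ≰ψ ē e∼v φ))
    ψ∈false : eval A e′ ψ ∈ Side φ≰ψ ē false
    ψ∈false = 0 , ≤₁-refl
    ψ∈true : eval A e′ ψ ∈ Side φ≰ψ ē true
    ψ∈true = subst (λ s → eval A e′ ψ ∈ Side φ≰ψ ē s)
      (sym (trans φ-true (cong designated (valid v)))) (proj₁ (∼-eval φ≰ψ ē e′∼v ψ))

  valid⇒≈ : ∀ φ ψ (e e′ : ℕ → Carrier) →
    (∀ v → eval (FOUR b) (v ∘ e) φ ≡ eval (FOUR b) (v ∘ e′) ψ) →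
    eval A e φ ≈ eval A e′ ψ
  valid⇒≈ φ ψ e e′ valid = ≤₁-separates
    (valid⇒≤₁ φ ψ e e′ valid)
    (valid⇒≤₁ ψ φ e′ e (sym ∘ valid))
    (valid⇒≤₁ (neg φ) (neg ψ) e e′ (cong fourNeg ∘ valid))
    (valid⇒≤₁ (neg ψ) (neg φ) e′ e (sym ∘ cong fourNeg ∘ valid))

  -- The g-matrix of all LB-filters

  principal : Carrier → Subset A
  principal x = (x ≤₁_) , λ y≈z x≤y → ≤₁-trans x≤y (≤₁-reflexive y≈z)

  -- Γ may be infinite: no compactness is needed, since the valuation refuting
  -- Γ ⊨ φ is built along all variables at once.

  principal-isLBFilter : ∀ x → IsLBFilter A (principal x)
  principal-isLBFilter x Γ φ Γ⊨φ h x≤Γ with em {x ≤₁ Hom.fun h φ}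
  ... | yes x≤φ = x≤φ
  ... | no  x≰φ = contradiction (0 , ≤₁-refl) (Side-disjoint x≰φ e φ∈true)
    where
    open Hom h
    e : ℕ → Carrier
    e = fun ∘ var
    k : Hom Fm (FOUR 0ℓ)
    k = evalHom (FOUR 0ℓ) (valuation x≰φ e ∘ e)
    truth : ∀ ψ → fun ψ ∈ Side x≰φ e (designated (Hom.fun k ψ))
    truth ψ = proj₁ (∼-resp x≰φ e eval≈fun (∼-eval x≰φ e (valuation-∼ x≰φ e) ψ))
      where
      eval≈fun : eval A e ψ ≈ fun ψ
      eval≈fun = ≈.trans (≈.sym (hom-eval h var ψ)) (fun-cong (eval-var ψ))
    Γ-designated : ∀ {ψ} → ψ ∈ Γ → Hom.fun k ψ ∈ Tr
    Γ-designated {ψ} ψ∈Γ = designated⇒Tr (Side-unique x≰φ e _ true (truth ψ) (0 , x≤Γ ψ∈Γ))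
    φ∈true : fun φ ∈ Side x≰φ e true
    φ∈true = subst (λ s → fun φ ∈ Side x≰φ e s) (Tr⇒designated (Γ⊨φ k Γ-designated)) (truth φ)

  distributiveBilattice∈AlgLB : AlgLB A
  distributiveBilattice∈AlgLB = record
    { 𝓒               = λ F → Lift (lsuc ℓ) (IsLBFilter A F)
    ; isClosureSystem = λ I F F∈𝓒 G (G⊆⋂ , ⋂⊆G) → lift λ Γ φ Γ⊨φ h Γ∈G →
        ⋂⊆G λ i → lower (F∈𝓒 i) Γ φ Γ⊨φ h λ ψ∈Γ → G⊆⋂ (Γ∈G ψ∈Γ) i
    ; isGModel        = lower
    ; isReduced       = record
      { isCongruence = record
        { isEquivalence = isEquivalence
        ; reflexive     = id
        ; ⟦⟧-compatible = ⟦⟧-cong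
        ; ¬-compatible  = ¬-cong
        }
      ; compatible   = λ F _ → proj₂ F
      ; greatest     = λ η η-cong η-comp xηy →
          let open IsCongruence η-cong using (¬-compatible)
              module η = IsEquivalence (IsCongruence.isEquivalence η-cong)
              below : ∀ {x y} → η x y → x ≤₁ y
              -- The principal filter of `x` contains `x`, so compatibility puts `y` into it.
              below {x} xηy = η-comp (principal x) (lift (principal-isLBFilter x)) xηy ≤₁-refl
          in ≤₁-separates (below xηy) (below (η.sym xηy))
               (below (¬-compatible xηy)) (below (¬-compatible (η.sym xηy)))
      }
    }

  -- A formula with an assignment of its variables in A stands for a term over A,
  -- and two terms are identified when all valuations A → FOUR agree on them.

  private
    Term : Set ℓ
    Term = Formula × (ℕ → Carrier)

    value : (B : Algebra b) → (Carrier → Algebra.Carrier B) → Term → Algebra.Carrier B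
    value B v (φ , e) = eval B (v ∘ e) φ

    -- Variables are renamed apart to even and odd indices, where the interleaved assignment keeps
    -- the parameters of each term.
    combine : Connective → Op₂ Term
    combine c (φ , e) (ψ , e′) =
      app c (rename double φ) (rename (suc ∘ double) ψ) , interleave e e′

    value-combine : (B : Algebra b) → let module B = Algebra B in
      ∀ v c s t → value B v (combine c s t) B.≈ B.⟦ c ⟧ (value B v s) (value B v t)
    value-combine B v c (φ , e) (ψ , e′) = B.⟦⟧-cong c
      (B≈.trans (eval-rename B _ double φ)
        (eval-cong B (λ n → B≈.reflexive (cong v (interleave-even e e′ n))) φ))
      (B≈.trans (eval-rename B _ (suc ∘ double) ψ)
        (eval-cong B (λ n → B≈.reflexive (cong v (interleave-odd e e′ n))) ψ))
      where
      module B  = Algebra B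
      module B≈ = IsEquivalence B.isEquivalence

    termAlgebra : Algebra ℓ
    termAlgebra = record
      { Carrier       = Term
      ; _≈_           = λ s t → ∀ v → value (FOUR ℓ) v s ≡ value (FOUR ℓ) v t
      ; isEquivalence = record
        { refl  = λ _ → refl
        ; sym   = λ s≡t v → sym (s≡t v)
        ; trans = λ s≡t t≡u v → trans (s≡t v) (t≡u v)
        }
      ; ⟦_⟧           = combine
      ; ¬_            = λ (φ , e) → neg φ , e
      ; ⟦⟧-cong       = λ c {s} {s′} {t} {t′} s≡s′ t≡t′ v →
          trans (value-combine (FOUR ℓ) v c s t)
            (trans (cong₂ (four c) (s≡s′ v) (t≡t′ v))
                   (sym (value-combine (FOUR ℓ) v c s′ t′)))
      ; ¬-cong        = λ s≡t v → cong fourNeg (s≡t v)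
      }

    embedding : Hom termAlgebra (Π (Carrier → Four ℓ) (λ _ → FOUR ℓ))
    embedding = record
      { fun      = λ t v → value (FOUR ℓ) v t
      ; fun-cong = id
      ; ⟦⟧-homo  = λ c s t v → value-combine (FOUR ℓ) v c s t
      ; ¬-homo   = λ _ _ → refl
      }

    evaluation : Hom termAlgebra A
    evaluation = record
      { fun      = value A id
      -- Well-definedness is the completeness of FOUR for equations over `A`.
      ; fun-cong = λ { {φ , e} {ψ , e′} → valid⇒≈ φ ψ e e′ }
      ; ⟦⟧-homo  = value-combine A id
      ; ¬-homo   = λ _ → ≈.refl
      }

  distributiveBilattice∈variety : A ∈ VarietyGeneratedBy (FOUR ℓ)
  distributiveBilattice∈variety = image evaluation
    (λ x → (var 0 , const x) , λ {z} → Hom.fun-cong evaluation {z} {var 0 , const x})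
    -- Equality of terms is by definition equality of their images in the power of FOUR, so
    -- injectivity is `id`.
    (subalgebra embedding id (product _ _ λ _ → generator))

theorem3p4p5 : {ℓ : Level} → ExcludedMiddle (lsuc ℓ) →
    (AlgLB {ℓ} ≐ VarietyGeneratedBy (FOUR ℓ)) ×
    (VarietyGeneratedBy (FOUR ℓ) ≐ IsDistributiveBilattice)
theorem3p4p5 {ℓ} em =
  ( (λ {A} A∈AlgLB → isDB⇒∈V (satisfies⇒isDistributiveBilattice A (algLB⊆satisfies A∈AlgLB)))
  , (λ A∈V → Separation.distributiveBilattice∈AlgLB (∈V⇒isDB A∈V) em′) ) ,
  ( ∈V⇒isDB , isDB⇒∈V )
  where
  em′ : ExcludedMiddle ℓ
  em′ {P} = map′ lower lift (em {Lift (lsuc ℓ) P})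
  ∈V⇒isDB : VarietyGeneratedBy (FOUR ℓ) ⊆ IsDistributiveBilattice
  ∈V⇒isDB {A} A∈V = satisfies⇒isDistributiveBilattice A (variety⊆satisfies FOUR-satisfies A∈V)
  isDB⇒∈V : IsDistributiveBilattice ⊆ VarietyGeneratedBy (FOUR ℓ)
  isDB⇒∈V isDB = Separation.distributiveBilattice∈variety isDB em′
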